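{- For $n\ge 4$ let $M_c(n)$ denote the maximum of $\operatorname{th}_{\gamma_P}^{\times}(G)\cdot\operatorname{th}_{\gamma_P}^{\times}(\overline G)$ over all graphs $G$ of order $n$ such that both $G$ and its complement $\overline G$ are connected. Then $M_c(n)=\Theta(n)$.
   Context: Graphs are finite, simple, undirected, with nonempty vertex set; the order of $G$ is $|V(G)|$; $\overline G$ is the complement of $G$. Power domination: for $B\subseteq V(G)$ put $B^{[0]}=B$ and $B^{[1]}=N[B]$ (the vertices of $B$ and all their neighbors); for $i\ge1$, $B^{[i+1]}$ is $B^{[i]}$ together with every vertex $w\notin B^{[i]}$ that is the unique neighbor outside $B^{[i]}$ of some vertex $v\in B^{[i]}$. $\operatorname{pt}_{\gamma_P}(G;B)$ is the least $t$ with $B^{[t]}=V(G)$ ($\infty$ if none exists), and $\operatorname{pt}_{\gamma_P}(G,k)=\min_{|B|=k}\operatorname{pt}_{\gamma_P}(G;B)$. For $G$ of order $n$ the initial cost product throttling number is $\operatorname{th}_{\gamma_P}^{\times}(G)=\min_{1\le k\le n}k(1+\operatorname{pt}_{\gamma_P}(G,k))$. $f=\Theta(g)$ means there are positive constants $c,C,k$ with $c\,g(n)\le f(n)\le C\,g(n)$ for all $n\ge k$. -}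

module Defs where

open import Data.Bool.Base using (Bool; true; false)
import Data.Bool.Properties as Bool
open import Data.Fin.Base using (Fin; zero; suc)
import Data.Fin.Properties as Fin
open import Data.Fin.Subset
  using (Subset; inside; outside; _∈_; _∉_; _⊆_; ∣_∣; ⊤; ⁅_⁆)
open import Data.Fin.Subset.Properties
  using (_∈?_; ⊆-antisym; ⊆⊤; ∣p∣≤n; ∣p∣≡n⇒p≡⊤; ∣⊤∣≡n; p⊂q⇒∣p∣<∣q∣;
         x∈⁅x⁆; x∈⁅y⁆⇒x≡y)
open import Data.Integer.Base using (+_)
open import Data.List.Base
  using (List; []; _∷_; map; filter; upTo; applyUpTo; cartesianProductWith)
import Data.List.Extrema
import Data.List.Extrema.Nat as ℕMax
open import Data.List.Membership.Propositional using () renaming (_∈_ to _∈ˡ_)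
open import Data.List.Membership.Propositional.Properties
  using (∈-map⁺; ∈-map⁻; ∈-filter⁺; ∈-filter⁻; ∈-upTo⁺; ∈-applyUpTo⁺;
         ∈-applyUpTo⁻; ∈-cartesianProductWith⁺)
import Data.List.Properties as List
import Data.List.Relation.Unary.All as All
open import Data.List.Relation.Unary.Any using (here; there)
open import Data.Nat.Base
  using (ℕ; zero; suc; _+_; _*_; _≤_; _<_; z≤n; s≤s; NonZero)
import Data.Nat.Properties as ℕ
open import Data.Product.Base using (∃; ∃-syntax; _×_; _,_; proj₁; proj₂)
open import Data.Rational.Base as ℚ using (ℚ; 0ℚ; _/_)
open import Data.Sum.Base using (_⊎_; inj₁; inj₂)
open import Data.Vec.Base using (Vec; []; _∷_; lookup; tabulate)
import Data.Vec.Properties as Vec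
open import Function.Base using (_∘_)
open import Function.Bundles using (_⇔_; mk⇔; module Equivalence)
open import Level using (0ℓ)
open import Relation.Binary.Bundles using (TotalOrder)
open import Relation.Binary.Construct.Add.Supremum.NonStrict _≤_
  using (_≤⁺_; [_]; _≤⊤⁺; ≤⁺-isTotalOrder-≡)
open import Relation.Binary.Construct.Closure.ReflexiveTransitive as Star
  using (Star; ε; _◅_; _◅◅_)
open import Relation.Binary.Core using (Rel)
import Relation.Binary.Definitions as B
open import Relation.Binary.PropositionalEquality
  using (_≡_; _≢_; refl; sym; trans; cong; cong₂; subst)
open import Relation.Nullary.Construct.Add.Supremum using (_⁺; ⊤⁺; [_])
open import Relation.Nullary.Decidable
  using (Dec; yes; no; does; map′; _×-dec_; _⊎-dec_; _→-dec_; ¬?; dec-true; does-⇔)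
open import Relation.Nullary.Negation using (¬_; contradiction)
open import Relation.Unary using (Pred; Decidable)

private
  variable
    n : ℕ

------------------------------------------------------------------------
-- Graphs

record Graph (n : ℕ) : Set₁ where
  field
    Adj    : Rel (Fin n) 0ℓ
    adj?   : B.Decidable Adj
    symm   : B.Symmetric Adj
    irrefl : ∀ v → ¬ Adj v v

open Graph public

_ᶜ : Graph n → Graph n
(G ᶜ) .Adj u v                  = u ≢ v × ¬ Adj G u v
(G ᶜ) .adj? u v                 = ¬? (u Fin.≟ v) ×-dec ¬? (adj? G u v)
(G ᶜ) .symm (u≢v , ¬uv)         = (u≢v ∘ sym) , (¬uv ∘ symm G)
(G ᶜ) .irrefl v (v≢v , _)       = v≢v refl

Connected : Graph n → Set
Connected G = ∀ u v → Star (Adj G) u v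

Coconnected : Graph n → Set
Coconnected G = Connected G × Connected (G ᶜ)

------------------------------------------------------------------------
-- Power domination

subset : {P : Pred (Fin n) 0ℓ} → Decidable P → Subset n
subset P? = tabulate (does ∘ P?)

module _ (G : Graph n) where

  InN[_] : Subset n → Fin n → Set
  InN[ S ] w = w ∈ S ⊎ ∃[ v ] (v ∈ S × Adj G v w)

  inN[_]? : ∀ S → Decidable InN[ S ]
  inN[ S ]? w = (w ∈? S) ⊎-dec Fin.any? (λ v → (v ∈? S) ×-dec adj? G v w)

  N[_] : Subset n → Subset n
  N[ S ] = subset inN[ S ]?

  Forces : Subset n → Fin n → Fin n → Set
  Forces S v w = Adj G v w × w ∉ S × (∀ x → Adj G v x → x ∉ S → x ≡ w)

  InStep : Subset n → Fin n → Set
  InStep S w = w ∈ S ⊎ ∃[ v ] (v ∈ S × Forces S v w)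

  inStep? : ∀ S → Decidable (InStep S)
  inStep? S w = (w ∈? S) ⊎-dec Fin.any? λ v → (v ∈? S) ×-dec
    (adj? G v w ×-dec ¬? (w ∈? S) ×-dec
      Fin.all? λ x → adj? G v x →-dec (¬? (x ∈? S) →-dec (x Fin.≟ w)))

  step : Subset n → Subset n
  step S = subset (inStep? S)

  -- monitored B t is the set B^[t] observed after t steps.
  monitored : Subset n → ℕ → Subset n
  monitored B 0             = B
  monitored B 1             = N[ B ]
  monitored B (suc (suc i)) = step (monitored B (suc i))

------------------------------------------------------------------------
-- Throttling numbers

ℕ∞ : Set
ℕ∞ = ℕ ⁺

ℕ∞-totalOrder : TotalOrder 0ℓ 0ℓ 0ℓ
ℕ∞-totalOrder = record { isTotalOrder = ≤⁺-isTotalOrder-≡ ℕ.≤-isTotalOrder }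

private
  module ℕ∞ = TotalOrder ℕ∞-totalOrder
  module Min = Data.List.Extrema ℕ∞-totalOrder

-- The minimum of the empty list is ∞.
minimum : List ℕ∞ → ℕ∞
minimum = Min.min ⊤⁺

vectors : {A : Set} → List A → ∀ m → List (Vec A m)
vectors xs zero    = [] ∷ []
vectors xs (suc m) = cartesianProductWith _∷_ xs (vectors xs m)

allSubsets : ∀ n → List (Subset n)
allSubsets = vectors (outside ∷ inside ∷ [])

_≟ˢ_ : B.DecidableEquality (Subset n)
_≟ˢ_ = Vec.≡-dec Bool._≟_

-- It suffices to search t ≤ 1 + n: after the first step the monitored sets
-- grow strictly until they stabilise (see pt-isMinimum).
pt[_⨾_] : Graph n → Subset n → ℕ∞
pt[_⨾_] {n} G B =
  minimum (map [_] (filter (λ t → monitored G B t ≟ˢ ⊤) (upTo (2 + n))))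

pt[_,_] : Graph n → ℕ → ℕ∞
pt[_,_] {n} G k =
  minimum (map pt[ G ⨾_] (filter (λ B → ∣ B ∣ ℕ.≟ k) (allSubsets n)))

-- k · (1 + p), with k · ∞ = ∞; only used for k ≥ 1.
cost : ℕ → ℕ∞ → ℕ∞
cost k [ p ] = [ k * (1 + p) ]
cost k ⊤⁺    = ⊤⁺

th∞ : Graph n → ℕ∞
th∞ {n} G = minimum (map (λ k → cost k pt[ G , k ]) (applyUpTo suc n))

finitePart : ℕ∞ → ℕ
finitePart [ m ] = m
finitePart ⊤⁺    = 0

-- For n ≥ 1 the minimum th∞ G is finite, so th G is its value
-- (see th∞-finite and th-isMinimum).
th : Graph n → ℕ
th G = finitePart (th∞ G)

------------------------------------------------------------------------
-- The maximum M_c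

-- The set of vertices at distance at most t from u.
walk : Graph n → Fin n → ℕ → Subset n
walk G u zero    = ⁅ u ⁆
walk G u (suc t) = N[_] G (walk G u t)

∈-subset⁺ : {P : Pred (Fin n) 0ℓ} (P? : Decidable P) → ∀ {x} → P x → x ∈ subset P?
∈-subset⁺ P? {x} px = Vec.lookup⇒[]= x _
  (trans (Vec.lookup∘tabulate _ x) (dec-true (P? x) px))

∈-subset⁻ : {P : Pred (Fin n) 0ℓ} (P? : Decidable P) → ∀ {x} → x ∈ subset P? → P x
∈-subset⁻ P? {x} x∈
  with P? x | trans (sym (Vec.lookup∘tabulate (does ∘ P?) x)) (Vec.[]=⇒lookup x∈)
... | yes px | _  = px
... | no _   | ()

subset-cong : {P Q : Pred (Fin n) 0ℓ} (P? : Decidable P) (Q? : Decidable Q) →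
              (∀ x → P x ⇔ Q x) → subset P? ≡ subset Q?
subset-cong P? Q? P⇔Q = Vec.tabulate-cong λ x → does-⇔ (P⇔Q x) (P? x) (Q? x)

module Iterate (f : Subset n → Subset n) (infl : ∀ S → S ⊆ f S) where

  grows : ∀ S → f S ≡ S ⊎ suc ∣ S ∣ ≤ ∣ f S ∣
  grows S with Fin.any? (λ x → (x ∈? f S) ×-dec ¬? (x ∈? S))
  ... | yes new = inj₂ (p⊂q⇒∣p∣<∣q∣ (infl S , new))
  ... | no ¬new = inj₁ (⊆-antisym shrink (infl S))
    where
    shrink : f S ⊆ S
    shrink {x} x∈fS with x ∈? S
    ... | yes x∈S = x∈S
    ... | no  x∉S = contradiction (x , x∈fS , x∉S) ¬new

  module _ (F : ℕ → Subset n) (F-suc : ∀ t → F (suc t) ≡ f (F t)) where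

    fixedOrLarge : ∀ t → f (F t) ≡ F t ⊎ t ≤ ∣ F t ∣
    fixedOrLarge zero = inj₂ z≤n
    fixedOrLarge (suc t) rewrite F-suc t with fixedOrLarge t | grows (F t)
    ... | inj₁ fix | _         = inj₁ (cong f fix)
    ... | inj₂ _   | inj₁ fix  = inj₁ (cong f fix)
    ... | inj₂ t≤  | inj₂ grow = inj₂ (ℕ.≤-trans (s≤s t≤) grow)

    fixed : f (F n) ≡ F n
    fixed with fixedOrLarge n
    ... | inj₁ fix = fix
    ... | inj₂ n≤  = subst (λ S → f S ≡ S) (sym F≡⊤) (⊆-antisym ⊆⊤ (infl ⊤))
      where
      F≡⊤ : F n ≡ ⊤
      F≡⊤ = ∣p∣≡n⇒p≡⊤ (ℕ.≤-antisym (∣p∣≤n (F n)) n≤)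

    constant : ∀ d → F (d + n) ≡ F n
    constant zero    = refl
    constant (suc d) = trans (F-suc (d + n)) (trans (cong f (constant d)) fixed)

N-infl : (G : Graph n) → ∀ S → S ⊆ N[_] G S
N-infl G S = ∈-subset⁺ (inN[_]? G S) ∘ inj₁

walk-sound : (G : Graph n) → ∀ u t {v} → v ∈ walk G u t → Star (Adj G) u v
walk-sound G u zero v∈ with refl ← x∈⁅y⁆⇒x≡y u v∈ = ε
walk-sound G u (suc t) v∈ with ∈-subset⁻ (inN[_]? G (walk G u t)) v∈
... | inj₁ v∈′            = walk-sound G u t v∈′
... | inj₂ (w , w∈ , w~v) = walk-sound G u t w∈ ◅◅ (w~v ◅ ε)

walk-complete : (G : Graph n) → ∀ u {v} → Star (Adj G) u v → v ∈ walk G u n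
walk-complete {n} G u = go (start n)
  where
  start : ∀ t → u ∈ walk G u t
  start zero    = x∈⁅x⁆ u
  start (suc t) = N-infl G _ (start t)

  go : ∀ {w v} → w ∈ walk G u n → Star (Adj G) w v → v ∈ walk G u n
  go w∈ ε            = w∈
  go w∈ (w~x ◅ path) = go
    (subst (_ ∈_) (Iterate.fixed (N[_] G) (N-infl G) (walk G u) (λ _ → refl))
      (∈-subset⁺ (inN[_]? G (walk G u n)) (inj₂ (_ , w∈ , w~x))))
    path

connected? : (G : Graph n) → Dec (Connected G)
connected? {n} G = map′
  (λ all u v → walk-sound G u n (all u v))
  (λ con u v → walk-complete G u (con u v))
  (Fin.all? λ u → Fin.all? λ v → v ∈? walk G u n)

coconnected? : Decidable (Coconnected {n})
coconnected? G = connected? G ×-dec connected? (G ᶜ)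

fromRows : Vec (Subset n) n → Graph n
fromRows A .Adj u v    = u ≢ v × v ∈ lookup A u × u ∈ lookup A v
fromRows A .adj? u v   = ¬? (u Fin.≟ v) ×-dec (v ∈? lookup A u) ×-dec (u ∈? lookup A v)
fromRows A .symm (u≢v , v∈ , u∈) = (u≢v ∘ sym) , u∈ , v∈
fromRows A .irrefl v (v≢v , _)   = v≢v refl

thProduct : Graph n → ℕ
thProduct G = th G * th (G ᶜ)

-- Up to _≈_, every graph on Fin n occurs in this list (see allGraphs-complete).
allGraphs : ∀ n → List (Graph n)
allGraphs n = map fromRows (vectors (allSubsets n) n)

-- The default value 0 is irrelevant for n ≥ 4 (see Mc-isMaximum).
Mc : ℕ → ℕ
Mc n = ℕMax.max 0 (map thProduct (filter coconnected? (allGraphs n)))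

------------------------------------------------------------------------
-- Asymptotics

-- Rational constants c and C; by density of ℚ in ℝ this is no restriction.
_=Θ_ : (f g : ℕ → ℕ) → Set
f =Θ g = ∃[ c ] ∃[ C ] ∃[ k ] 0ℚ ℚ.< c × 0ℚ ℚ.< C × 0 < k ×
  (∀ n → k ≤ n → c ℚ.* (+ g n / 1) ℚ.≤ + f n / 1 × + f n / 1 ℚ.≤ C ℚ.* (+ g n / 1))

------------------------------------------------------------------------
-- Correctness of the enumerations above

IsMinimum : ℕ∞ → Pred ℕ∞ 0ℓ → Set
IsMinimum m P = P m × (∀ x → P x → m ≤⁺ x)

-- The minimum is ∞ when no value exists.
IsMinimum∞ : ℕ∞ → Pred ℕ∞ 0ℓ → Set
IsMinimum∞ m P = (m ≡ ⊤⁺ ⊎ P m) × (∀ x → P x → m ≤⁺ x)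

minimum≤ : ∀ {xs x} → x ∈ˡ xs → minimum xs ≤⁺ x
minimum≤ {xs} = All.lookup (Min.min≤xs ⊤⁺ xs)

minimum-isMinimum∞ : {A : Set} (f : A → ℕ∞) (xs : List A) {Q : Pred A 0ℓ} →
  (∀ {a} → a ∈ˡ xs → Q a) →
  (∀ {a} → Q a → ∃[ b ] (b ∈ˡ xs × f b ≤⁺ f a)) →
  IsMinimum∞ (minimum (map f xs)) (λ x → ∃[ a ] (Q a × x ≡ f a))
minimum-isMinimum∞ f xs {Q} sound complete = attained , lower
  where
  attained : minimum (map f xs) ≡ ⊤⁺ ⊎ ∃[ a ] (Q a × minimum (map f xs) ≡ f a)
  attained with Min.argmin-sel (λ x → x) ⊤⁺ (map f xs)
  ... | inj₁ eq = inj₁ eq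
  ... | inj₂ m∈ with a , a∈ , eq ← ∈-map⁻ f m∈ = inj₂ (a , sound a∈ , eq)

  lower : ∀ x → ∃[ a ] (Q a × x ≡ f a) → minimum (map f xs) ≤⁺ x
  lower _ (a , qa , refl) with b , b∈ , fb≤fa ← complete qa =
    ℕ∞.trans (minimum≤ (∈-map⁺ f b∈)) fb≤fa

∈-vectors : {A : Set} {xs : List A} → ∀ {m} (v : Vec A m) →
            (∀ i → lookup v i ∈ˡ xs) → v ∈ˡ vectors xs m
∈-vectors []      _  = here refl
∈-vectors (x ∷ v) v∈ =
  ∈-cartesianProductWith⁺ _∷_ (v∈ zero) (∈-vectors v (v∈ ∘ suc))

∈-allSubsets : (S : Subset n) → S ∈ˡ allSubsets n
∈-allSubsets S = ∈-vectors S (λ i → side (lookup S i))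
  where
  side : ∀ b → b ∈ˡ (outside ∷ inside ∷ [])
  side false = here refl
  side true  = there (here refl)

step-infl : (G : Graph n) → ∀ S → S ⊆ step G S
step-infl G S = ∈-subset⁺ (inStep? G S) ∘ inj₁

early : (G : Graph n) (B : Subset n) → ∀ t → monitored G B t ≡ ⊤ →
        ∃[ s ] (s < 2 + n × monitored G B s ≡ ⊤ × s ≤ t)
early {n} G B t eq with t ℕ.<? 2 + n
... | yes t< = t , t< , eq , ℕ.≤-refl
... | no  t≮ with ℕ.m≤n⇒∃[o]m+o≡n (ℕ.≮⇒≥ t≮)
...   | d , refl = suc n , ℕ.≤-refl , trans (sym stable) eq , ℕ.<⇒≤ (ℕ.m≤m+n (2 + n) d)
  where
  stable : monitored G B (2 + n + d) ≡ monitored G B (suc n)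
  stable = trans (cong (monitored G B ∘ suc) (ℕ.+-comm (suc n) d))
    (trans (cong (monitored G B ∘ suc) (ℕ.+-suc d n))
      (Iterate.constant (step G) (step-infl G) (monitored G B ∘ suc) (λ _ → refl) (suc d)))

pt-isMinimum : (G : Graph n) (B : Subset n) →
  IsMinimum∞ pt[ G ⨾ B ] (λ x → ∃[ t ] (monitored G B t ≡ ⊤ × x ≡ [ t ]))
pt-isMinimum {n} G B = minimum-isMinimum∞ [_] _
  (λ t∈ → proj₂ (∈-filter⁻ (λ t → monitored G B t ≟ˢ ⊤) {xs = upTo (2 + n)} t∈))
  (λ {t} eq → let s , s< , eqₛ , s≤t = early G B t eq in
    s , ∈-filter⁺ (λ t → monitored G B t ≟ˢ ⊤) (∈-upTo⁺ s<) eqₛ , [ s≤t ])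

ptₖ-isMinimum : (G : Graph n) (k : ℕ) →
  IsMinimum∞ pt[ G , k ] (λ x → ∃[ B ] (∣ B ∣ ≡ k × x ≡ pt[ G ⨾ B ]))
ptₖ-isMinimum {n} G k = minimum-isMinimum∞ pt[ G ⨾_] _
  (λ B∈ → proj₂ (∈-filter⁻ (λ B → ∣ B ∣ ℕ.≟ k) {xs = allSubsets n} B∈))
  (λ {B} eq → B , ∈-filter⁺ (λ B → ∣ B ∣ ℕ.≟ k) (∈-allSubsets B) eq , ℕ∞.refl)

th∞-isMinimum∞ : (G : Graph n) →
  IsMinimum∞ (th∞ G) (λ x → ∃[ k ] ((1 ≤ k × k ≤ n) × x ≡ cost k pt[ G , k ]))
th∞-isMinimum∞ {n} G = minimum-isMinimum∞ (λ k → cost k pt[ G , k ]) _ sound complete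
  where
  sound : ∀ {k} → k ∈ˡ applyUpTo suc n → 1 ≤ k × k ≤ n
  sound k∈ with i , i<n , refl ← ∈-applyUpTo⁻ suc k∈ = s≤s z≤n , i<n

  complete : ∀ {k} → 1 ≤ k × k ≤ n →
    ∃[ l ] (l ∈ˡ applyUpTo suc n × cost l pt[ G , l ] ≤⁺ cost k pt[ G , k ])
  complete {suc k} (_ , k<n) = suc k , ∈-applyUpTo⁺ suc k<n , ℕ∞.refl

private
  finite-cost : ∀ k {p q} → p ≤⁺ [ q ] → cost k p ≢ ⊤⁺
  finite-cost k [ _ ] ()

  finite-≤ : ∀ {x y} → x ≤⁺ y → y ≢ ⊤⁺ → x ≡ [ finitePart x ]
  finite-≤ [ _ ]    y≢∞ = refl
  finite-≤ (_ ≤⊤⁺)  y≢∞ = contradiction refl y≢∞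

th∞-finite : {{_ : NonZero n}} (G : Graph n) → th∞ G ≡ [ th G ]
th∞-finite {n@(suc _)} G = finite-≤
  (proj₂ (th∞-isMinimum∞ G) (cost n pt[ G , n ]) (n , (s≤s z≤n , ℕ.≤-refl) , refl))
  (finite-cost n ptₙ≤0)
  where
  ptₙ≤0 : pt[ G , n ] ≤⁺ [ 0 ]
  ptₙ≤0 = ℕ∞.trans
    (proj₂ (ptₖ-isMinimum G n) pt[ G ⨾ ⊤ ] (⊤ , ∣⊤∣≡n n , refl))
    (proj₂ (pt-isMinimum G ⊤) [ 0 ] (0 , refl , refl))

th-isMinimum : {{_ : NonZero n}} (G : Graph n) →
  IsMinimum [ th G ] (λ x → ∃[ k ] ((1 ≤ k × k ≤ n) × x ≡ cost k pt[ G , k ]))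
th-isMinimum {n} G = finish (th∞-finite G) (th∞-isMinimum∞ G)
  where
  finish : ∀ {m a P} → m ≡ [ a ] → IsMinimum∞ m P → IsMinimum [ a ] P
  finish refl (inj₂ attained , lower) = attained , lower

infix 4 _≈_

_≈_ : Graph n → Graph n → Set
G ≈ H = ∀ u v → Adj G u v ⇔ Adj H u v

private
  module _ {G H : Graph n} (G≈H : G ≈ H) where

    to : ∀ {u v} → Adj G u v → Adj H u v
    to = Equivalence.to (G≈H _ _)

    from : ∀ {u v} → Adj H u v → Adj G u v
    from = Equivalence.from (G≈H _ _)

    ᶜ-cong : G ᶜ ≈ H ᶜ
    ᶜ-cong u v = mk⇔ (λ (u≢v , ¬uv) → u≢v , ¬uv ∘ from) (λ (u≢v , ¬uv) → u≢v , ¬uv ∘ to)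

    connected-cong : Connected G → Connected H
    connected-cong con u v = Star.map to (con u v)

    N-cong : ∀ S → N[_] G S ≡ N[_] H S
    N-cong S = subset-cong (inN[_]? G S) (inN[_]? H S) λ w → mk⇔
      (λ { (inj₁ w∈) → inj₁ w∈ ; (inj₂ (v , v∈ , v~w)) → inj₂ (v , v∈ , to v~w) })
      (λ { (inj₁ w∈) → inj₁ w∈ ; (inj₂ (v , v∈ , v~w)) → inj₂ (v , v∈ , from v~w) })

    step-cong : ∀ S → step G S ≡ step H S
    step-cong S = subset-cong (inStep? G S) (inStep? H S) λ w → mk⇔
      (λ { (inj₁ w∈) → inj₁ w∈
         ; (inj₂ (v , v∈ , v~w , w∉ , !)) → inj₂ (v , v∈ , to v~w , w∉ , λ x → ! x ∘ from) })
      (λ { (inj₁ w∈) → inj₁ w∈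
         ; (inj₂ (v , v∈ , v~w , w∉ , !)) → inj₂ (v , v∈ , from v~w , w∉ , λ x → ! x ∘ to) })

    monitored-cong : ∀ B t → monitored G B t ≡ monitored H B t
    monitored-cong B 0             = refl
    monitored-cong B 1             = N-cong B
    monitored-cong B (suc (suc i)) =
      trans (step-cong _) (cong (step H) (monitored-cong B (suc i)))

    pt-cong : ∀ B → pt[ G ⨾ B ] ≡ pt[ H ⨾ B ]
    pt-cong B = cong (minimum ∘ map [_]) (List.filter-≐ (λ t → monitored G B t ≟ˢ ⊤) (λ t → monitored H B t ≟ˢ ⊤)
      ((λ {t} → trans (sym (monitored-cong B t))) , (λ {t} → trans (monitored-cong B t)))
      (upTo (2 + n)))

    th-cong : th G ≡ th H
    th-cong = cong (finitePart ∘ minimum) (List.map-cong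
      (λ k → cong (cost k ∘ minimum) (List.map-cong pt-cong (filter (λ B → ∣ B ∣ ℕ.≟ k) (allSubsets n))))
      (applyUpTo suc n))

allGraphs-complete : (G : Graph n) → ∃[ H ] (H ∈ˡ allGraphs n × G ≈ H)
allGraphs-complete {n} G =
  fromRows rows , ∈-map⁺ fromRows (∈-vectors rows (λ u → ∈-allSubsets (lookup rows u))) , equiv
  where
  nbhd : Fin n → Subset n
  nbhd u = subset (adj? G u)

  rows : Vec (Subset n) n
  rows = tabulate nbhd

  row⁺ : ∀ {u v} → Adj G u v → v ∈ lookup rows u
  row⁺ {u} = subst (_ ∈_) (sym (Vec.lookup∘tabulate nbhd u)) ∘ ∈-subset⁺ (adj? G u)

  row⁻ : ∀ {u v} → v ∈ lookup rows u → Adj G u v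
  row⁻ {u} = ∈-subset⁻ (adj? G u) ∘ subst (_ ∈_) (Vec.lookup∘tabulate nbhd u)

  equiv : G ≈ fromRows rows
  equiv u v = mk⇔
    (λ u~v → (λ { refl → irrefl G u u~v }) , row⁺ u~v , row⁺ (symm G u~v))
    (λ (_ , v∈ , _) → row⁻ v∈)

-- The path on four vertices, with the last vertex replaced by twins.
private
  adjᵇ : ∀ {m} → Fin (4 + m) → Fin (4 + m) → Bool
  adjᵇ zero                (suc zero)          = true
  adjᵇ (suc zero)          zero                = true
  adjᵇ (suc zero)          (suc (suc zero))    = true
  adjᵇ (suc (suc zero))    (suc zero)          = true
  adjᵇ (suc (suc zero))    (suc (suc (suc _))) = true
  adjᵇ (suc (suc (suc _))) (suc (suc zero))    = true
  adjᵇ _                   _                   = false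

  broom : ∀ m → Graph (4 + m)
  broom m .Adj u v  = adjᵇ u v ≡ true
  broom m .adj? u v = adjᵇ u v Bool.≟ true
  broom m .symm {zero}              {suc zero}          _ = refl
  broom m .symm {suc zero}          {zero}              _ = refl
  broom m .symm {suc zero}          {suc (suc zero)}    _ = refl
  broom m .symm {suc (suc zero)}    {suc zero}          _ = refl
  broom m .symm {suc (suc zero)}    {suc (suc (suc _))} _ = refl
  broom m .symm {suc (suc (suc _))} {suc (suc zero)}    _ = refl
  broom m .irrefl zero                ()
  broom m .irrefl (suc zero)          ()
  broom m .irrefl (suc (suc zero))    ()
  broom m .irrefl (suc (suc (suc _))) ()

  fromHub : (G : Graph n) (h : Fin n) → (∀ v → Star (Adj G) v h) → Connected G
  fromHub G h toHub u v = toHub u ◅◅ Star.reverse (symm G) (toHub v)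

  broom-coconnected : ∀ m → Coconnected (broom m)
  broom-coconnected m =
      fromHub (broom m) (suc (suc zero)) toTwo
    , fromHub (broom m ᶜ) zero toZero
    where
    toTwo : ∀ v → Star (Adj (broom m)) v (suc (suc zero))
    toTwo zero                = _◅_ {j = suc zero} refl (refl ◅ ε)
    toTwo (suc zero)          = refl ◅ ε
    toTwo (suc (suc zero))    = ε
    toTwo (suc (suc (suc _))) = refl ◅ ε

    toZero : ∀ v → Star (Adj (broom m ᶜ)) v zero
    toZero zero                = ε
    toZero (suc zero)          =
      _◅_ {j = suc (suc (suc zero))} ((λ ()) , (λ ())) (((λ ()) , (λ ())) ◅ ε)
    toZero (suc (suc zero))    = ((λ ()) , (λ ())) ◅ ε
    toZero (suc (suc (suc _))) = ((λ ()) , (λ ())) ◅ ε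

product-≤-Mc : (G : Graph n) → Coconnected G → thProduct G ≤ Mc n
product-≤-Mc {n} G (con , conᶜ) with H , H∈ , G≈H ← allGraphs-complete G =
  subst (_≤ Mc n) (sym (cong₂ _*_ (th-cong {G = G} {H} G≈H) (th-cong {G = G ᶜ} {H ᶜ} Gᶜ≈Hᶜ)))
    (All.lookup (ℕMax.xs≤max 0 (map thProduct (filter coconnected? (allGraphs n))))
      (∈-map⁺ thProduct (∈-filter⁺ coconnected? H∈
        (connected-cong {G = G} {H} G≈H con , connected-cong {G = G ᶜ} {H ᶜ} Gᶜ≈Hᶜ conᶜ))))
  where
  Gᶜ≈Hᶜ : G ᶜ ≈ H ᶜ
  Gᶜ≈Hᶜ = ᶜ-cong {G = G} {H} G≈H

private
  Mc-sel : ∀ n → Mc n ≡ 0 ⊎ ∃[ G ] (Coconnected {n} G × Mc n ≡ thProduct G)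
  Mc-sel n with ℕMax.argmax-sel (λ x → x) 0 (map thProduct (filter coconnected? (allGraphs n)))
  ... | inj₁ Mc≡0 = inj₁ Mc≡0
  ... | inj₂ Mc∈ with G , G∈ , Mc≡ ← ∈-map⁻ thProduct Mc∈ =
    inj₂ (G , proj₂ (∈-filter⁻ coconnected? {xs = allGraphs n} G∈) , Mc≡)

Mc-isMaximum : 4 ≤ n →
  (∃[ G ] (Coconnected {n} G × Mc n ≡ thProduct G)) ×
  (∀ (G : Graph n) → Coconnected G → thProduct G ≤ Mc n)
Mc-isMaximum {n} 4≤n = attained , product-≤-Mc
  where
  example : 4 ≤ n → ∃ (Coconnected {n})
  example (s≤s (s≤s (s≤s (s≤s {n = m} z≤n)))) = broom m , broom-coconnected m

  attained : ∃[ G ] (Coconnected {n} G × Mc n ≡ thProduct G)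
  attained with Mc-sel n | example 4≤n
  ... | inj₂ max  | _       = max
  ... | inj₁ Mc≡0 | G , coG = G , coG ,
    trans Mc≡0 (sym (ℕ.n≤0⇒n≡0 (subst (thProduct G ≤_) Mc≡0 (product-≤-Mc G coG))))

{-# OPTIONS --safe #-}

-- Upper bound: th G ≤ 2 γ(G), since a dominating set needs one step.  Let m + 1 be the
-- domination number of G ᶜ.  No set of m vertices dominates G ᶜ, so any m vertices have
-- a common neighbour in G; cutting the vertex set into about n / m blocks of size m and
-- taking a common neighbour of each gives γ(G) ≤ n / m + 1, whence γ(G) γ(G ᶜ) ≤ 4 n;
-- for m = 0 the bound γ(G) ≤ n suffices.
--
-- Lower bound: take disjoint triangles, joined by a clique on one hub from each.  The two
-- other vertices of a triangle are twins, so neither can be forced while the other is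
-- unobserved: a power dominating set meets every triangle, and th G ≥ ⌊n/3⌋.

module Submission where

open import Defs
open import Data.Fin.Base using (Fin; zero; suc; toℕ; fromℕ<)
import Data.Fin.Properties as Fin
open import Data.Fin.Subset
  using (Subset; inside; outside; _∈_; _∉_; ∣_∣; ⊤; ⊥; ⁅_⁆; _∪_; ⋃; _-_)
open import Data.Fin.Subset.Properties
  using (_∈?_; ∈⊤; ∣⊥∣≡0; ∣⁅x⁆∣≡1; x∈⁅x⁆; x∈p∪q⁺; ⊆-antisym; ⊆⊤;
         x∈p⇒∣p-x∣<∣p∣; x∈p∧x≢y⇒x∈p-y; anySubset?; ∣p∣≤n)
open import Data.Integer.Base as ℤ using (+_; +≤+)
import Data.Integer.Properties as ℤ
open import Data.List.Base using (List; []; _∷_; map; length; take; drop; allFin)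
open import Data.List.Membership.Propositional using () renaming (_∈_ to _∈ˡ_)
open import Data.List.Membership.Propositional.Properties using (∈-++⁻; ∈-allFin)
import Data.List.Properties as List
open import Data.List.Relation.Unary.Any using (here; there)
open import Data.Nat.Base using (ℕ; zero; suc; _+_; _*_; _≤_; _<_; z≤n; s≤s)
open import Data.Nat.DivMod
  using (_/_; _%_; m≡m%n+[m/n]*n; m%n<n; m/n*n≤m; m*n/n≡m; m*n%n≡0; [m+kn]%n≡m%n;
         m<n⇒m/n≡0; +-distrib-/-∣ʳ; /-monoˡ-≤)
open import Data.Nat.Divisibility using (n∣m*n)
import Data.Nat.Properties as ℕ
open import Data.Nat.Tactic.RingSolver using (solve-∀)
open import Data.Product.Base using (∃-syntax; _×_; _,_; proj₁; proj₂)
open import Data.Rational.Base as ℚ using (0ℚ)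
import Data.Rational.Properties as ℚ
open import Data.Rational.Unnormalised.Base as ℚᵘ using (mkℚᵘ)
import Data.Rational.Unnormalised.Properties as ℚᵘ
open import Data.Sum.Base using (_⊎_; inj₁; inj₂)
open import Data.Vec.Base using ([]; _∷_)
open import Function.Base using (_∘_)
open import Level using (0ℓ)
open import Relation.Binary.Bundles using (TotalOrder)
open import Relation.Binary.Construct.Add.Supremum.NonStrict _≤_
  using (_≤⁺_; [_]; [≤]-injective)
open import Relation.Binary.Construct.Closure.ReflexiveTransitive as Star
  using (Star; ε; _◅_; _◅◅_)
open import Relation.Binary.PropositionalEquality
  using (_≡_; _≢_; refl; sym; trans; cong; cong₂; subst)
open import Relation.Nullary.Construct.Add.Supremum using ([_])
open import Relation.Nullary.Decidable
  using (Dec; yes; no; _×-dec_; _⊎-dec_; ¬?; toWitness; decidable-stable)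
open import Relation.Nullary.Negation using (¬_; contradiction)
open import Relation.Unary using (Pred; Decidable)

private
  variable
    n : ℕ

-- Cardinalities of finite subsets, and a discrete threshold.

∣p∪q∣≤∣p∣+∣q∣ : (p q : Subset n) → ∣ p ∪ q ∣ ≤ ∣ p ∣ + ∣ q ∣
∣p∪q∣≤∣p∣+∣q∣ []            []            = z≤n
∣p∪q∣≤∣p∣+∣q∣ (outside ∷ p) (outside ∷ q) = ∣p∪q∣≤∣p∣+∣q∣ p q
∣p∪q∣≤∣p∣+∣q∣ (outside ∷ p) (inside ∷ q)  =
  subst (suc ∣ p ∪ q ∣ ≤_) (sym (ℕ.+-suc ∣ p ∣ ∣ q ∣)) (s≤s (∣p∪q∣≤∣p∣+∣q∣ p q))
∣p∪q∣≤∣p∣+∣q∣ (inside ∷ p)  (outside ∷ q) = s≤s (∣p∪q∣≤∣p∣+∣q∣ p q)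
∣p∪q∣≤∣p∣+∣q∣ (inside ∷ p)  (inside ∷ q)  =
  s≤s (ℕ.≤-trans (∣p∪q∣≤∣p∣+∣q∣ p q) (ℕ.+-monoʳ-≤ ∣ p ∣ (ℕ.n≤1+n ∣ q ∣)))

∣⁅x⁆∪p∣≤1+∣p∣ : (x : Fin n) (p : Subset n) → ∣ ⁅ x ⁆ ∪ p ∣ ≤ suc ∣ p ∣
∣⁅x⁆∪p∣≤1+∣p∣ x p =
  subst (λ k → ∣ ⁅ x ⁆ ∪ p ∣ ≤ k + ∣ p ∣) (∣⁅x⁆∣≡1 x) (∣p∪q∣≤∣p∣+∣q∣ ⁅ x ⁆ p)

fromList : List (Fin n) → Subset n
fromList xs = ⋃ (map ⁅_⁆ xs)

∣fromList∣≤length : (xs : List (Fin n)) → ∣ fromList xs ∣ ≤ length xs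
∣fromList∣≤length {n} []   = ℕ.≤-reflexive (∣⊥∣≡0 n)
∣fromList∣≤length (x ∷ xs) =
  ℕ.≤-trans (∣⁅x⁆∪p∣≤1+∣p∣ x (fromList xs)) (s≤s (∣fromList∣≤length xs))

∈-fromList⁺ : ∀ {xs} {x : Fin n} → x ∈ˡ xs → x ∈ fromList xs
∈-fromList⁺ (here refl) = x∈p∪q⁺ (inj₁ (x∈⁅x⁆ _))
∈-fromList⁺ (there x∈)  = x∈p∪q⁺ (inj₂ (∈-fromList⁺ x∈))

-- Induction on `q`: deleting `f zero` makes `p` strictly smaller, and injectivity keeps the
-- remaining images in it.
injection⇒≤∣p∣ : ∀ {q} (f : Fin q → Fin n) → (∀ {i j} → f i ≡ f j → i ≡ j) →
                 (p : Subset n) → (∀ i → f i ∈ p) → q ≤ ∣ p ∣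
injection⇒≤∣p∣ {q = zero}  f inj p f∈ = z≤n
injection⇒≤∣p∣ {q = suc q} f inj p f∈ = ℕ.≤-trans
  (s≤s (injection⇒≤∣p∣ (f ∘ suc) (Fin.suc-injective ∘ inj) (p - f zero)
    (λ i → x∈p∧x≢y⇒x∈p-y (f∈ (suc i)) (λ eq → contradiction (inj eq) λ ()))))
  (x∈p⇒∣p-x∣<∣p∣ (f∈ zero))

-- Descending from `n` while `P` holds, the search must stop because `P 0` fails. With `P m` saying
-- that some set of at most `m` vertices dominates, `suc m` is the domination number.
threshold : {P : ℕ → Set} → (∀ m → Dec (P m)) → ¬ P 0 → ∀ n → P n →
            ∃[ m ] (m < n × ¬ P m × P (suc m))
threshold P? ¬P0 zero    P0 = contradiction P0 ¬P0
threshold P? ¬P0 (suc n) Pn with P? n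
... | no ¬p = n , ℕ.≤-refl , ¬p , Pn
... | yes p with m , m<n , rest ← threshold P? ¬P0 n p = m , ℕ.m<n⇒m<1+n m<n , rest

-- Costs and attained minima in `ℕ∞`.

cost-mono : ∀ k {p q} → p ≤⁺ [ q ] → cost k p ≤⁺ [ k * (1 + q) ]
cost-mono k [ p≤q ] = [ ℕ.*-monoʳ-≤ k (s≤s p≤q) ]

cost-finite : ∀ k p {m} → [ m ] ≡ cost k p → ∃[ q ] (p ≡ [ q ] × m ≡ k * (1 + q))
cost-finite k [ q ] refl = q , refl , refl

finite-attained : ∀ {m q} {P : Pred ℕ∞ 0ℓ} → IsMinimum∞ m P → m ≡ [ q ] → P [ q ]
finite-attained (inj₂ attained , _) refl = attained

[]-injective : ∀ {a b : ℕ} → _≡_ {A = ℕ∞} [ a ] [ b ] → a ≡ b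
[]-injective refl = refl

-- Dominating sets and the throttling number.

Dominating : Graph n → Subset n → Set
Dominating G S = ∀ w → InN[_] G S w

dominating? : (G : Graph n) → Decidable (Dominating G)
dominating? G S = Fin.all? (inN[_]? G S)

⊤-dominating : (G : Graph n) → Dominating G ⊤
⊤-dominating G w = inj₁ ∈⊤

dominating⇒nonempty : (G : Graph (suc n)) {S : Subset (suc n)} → Dominating G S → 1 ≤ ∣ S ∣
dominating⇒nonempty G {S} dom = member (dom zero)
  where
  size : ∀ {x} → x ∈ S → 1 ≤ ∣ S ∣
  size x∈ = ℕ.≤-trans (s≤s z≤n) (x∈p⇒∣p-x∣<∣p∣ x∈)

  member : InN[_] G S zero → 1 ≤ ∣ S ∣
  member (inj₁ x∈)           = size x∈
  member (inj₂ (_ , x∈ , _)) = size x∈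

-- Everything is observed at time 1, so `S` costs `∣ S ∣ * (1 + 1)`; each of the three nested minima
-- is bounded by this candidate.
th≤2∣S∣ : (G : Graph (suc n)) {S : Subset (suc n)} → Dominating G S → th G ≤ ∣ S ∣ * 2
th≤2∣S∣ G {S} dom = [≤]-injective (≤⁺.trans
  (proj₂ (th-isMinimum G) _ (∣ S ∣ , (dominating⇒nonempty G dom , ∣p∣≤n S) , refl))
  (cost-mono ∣ S ∣ (≤⁺.trans
    (proj₂ (ptₖ-isMinimum G ∣ S ∣) _ (S , refl , refl))
    (proj₂ (pt-isMinimum G S) _ (1 , N≡⊤ , refl)))))
  where
  module ≤⁺ = TotalOrder ℕ∞-totalOrder

  N≡⊤ : N[_] G S ≡ ⊤
  N≡⊤ = ⊆-antisym ⊆⊤ (λ {w} _ → ∈-subset⁺ (inN[_]? G S) (dom w))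

module _ (G : Graph (suc n)) where

  private
    Attained : Set
    Attained = ∃[ B ] ∃[ t ] (1 ≤ ∣ B ∣ × monitored G B t ≡ ⊤ × th G ≡ ∣ B ∣ * (1 + t))

    -- Neither `with` nor matching on refl is used here: both make Agda normalise th G.
    fromSet : ∀ {k q} B → 1 ≤ k → ∣ B ∣ ≡ k → th G ≡ k * (1 + q) →
              ∃[ t ] (monitored G B t ≡ ⊤ × _≡_ {A = ℕ∞} [ q ] [ t ]) → Attained
    fromSet B 1≤k ∣B∣≡k th≡ (t , mon≡⊤ , q≡t) =
      B , t , subst (1 ≤_) (sym ∣B∣≡k) 1≤k , mon≡⊤ ,
      trans th≡ (cong₂ (λ k t → k * (1 + t)) (sym ∣B∣≡k) ([]-injective q≡t))

    fromTime : ∀ k → 1 ≤ k → ∃[ q ] (pt[ G , k ] ≡ [ q ] × th G ≡ k * (1 + q)) → Attained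
    fromTime k 1≤k (q , pt≡ , th≡) = fromBest (finite-attained (ptₖ-isMinimum G k) pt≡)
      where
      fromBest : ∃[ B ] (∣ B ∣ ≡ k × [ q ] ≡ pt[ G ⨾ B ]) → Attained
      fromBest (B , ∣B∣≡k , ptB≡) =
        fromSet B 1≤k ∣B∣≡k th≡ (finite-attained (pt-isMinimum G B) (sym ptB≡))

    fromSize : ∃[ k ] ((1 ≤ k × k ≤ suc n) × [ th G ] ≡ cost k pt[ G , k ]) → Attained
    fromSize (k , (1≤k , _) , th≡) = fromTime k 1≤k (cost-finite k pt[ G , k ] th≡)

  -- The three nested minima, over sizes, sets and times, are peeled off in turn; finiteness of
  -- `th G` excludes the default value ∞ at each level.
  th-attained : Attained
  th-attained = fromSize (proj₁ (th-isMinimum G))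

  1≤th : 1 ≤ th G
  1≤th = let _ , t , 1≤∣B∣ , _ , th≡ = th-attained in
    subst (1 ≤_) (sym th≡) (ℕ.*-mono-≤ 1≤∣B∣ (s≤s z≤n))

-- Domination in a graph and its complement.

nonDominatingᶜ⇒commonNeighbour : (G : Graph n) {S : Subset n} → ¬ Dominating (G ᶜ) S →
  ∃[ z ] (∀ {v} → v ∈ S → Adj G z v)
nonDominatingᶜ⇒commonNeighbour G {S} ¬dom
  with z , ¬z ← Fin.¬∀⟶∃¬ _ (InN[_] (G ᶜ) S) (inN[_]? (G ᶜ) S) ¬dom =
  -- If `v` in `S` were not adjacent to `z` in `G`, it would dominate `z` in the complement; the
  -- case `z = v` would put `z` into `S`.
  z , λ {v} v∈ → decidable-stable (adj? G z v) λ ¬zv →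
    ¬z (inj₂ (v , v∈ , (λ { refl → ¬z (inj₁ v∈) }) , ¬zv ∘ symm G))

-- Each unit of `q` pays for one vertex adjacent to all of the first `m` entries; the recursion
-- treats the rest of the list.
blockCover : (G : Graph n) (m : ℕ) →
  (∀ S → ∣ S ∣ ≤ m → ∃[ z ] (∀ {v} → v ∈ S → Adj G z v)) →
  ∀ q xs → length xs ≤ q * m →
  ∃[ B ] (∣ B ∣ ≤ q × (∀ {x} → x ∈ˡ xs → ∃[ y ] (y ∈ B × Adj G y x)))
blockCover {n} G m common zero [] _ = ⊥ , ℕ.≤-reflexive (∣⊥∣≡0 n) , λ ()
blockCover G m common (suc q) xs len≤
  with z , z~ ← common (fromList (take m xs))
         (ℕ.≤-trans (∣fromList∣≤length (take m xs))
           (ℕ.≤-trans (ℕ.≤-reflexive (List.length-take m xs)) (ℕ.m⊓n≤m m (length xs))))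
     | B , ∣B∣≤q , B~ ← blockCover G m common q (drop m xs)
         (ℕ.≤-trans (ℕ.≤-reflexive (List.length-drop m xs)) (ℕ.m≤n+o⇒m∸n≤o _ m len≤)) =
  ⁅ z ⁆ ∪ B , ℕ.≤-trans (∣⁅x⁆∪p∣≤1+∣p∣ z B) (s≤s ∣B∣≤q) , covered
  where
  covered : ∀ {x} → x ∈ˡ xs → ∃[ y ] (y ∈ ⁅ z ⁆ ∪ B × Adj G y x)
  covered {x} x∈ with ∈-++⁻ (take m xs) (subst (x ∈ˡ_) (sym (List.take++drop≡id m xs)) x∈)
  ... | inj₁ x∈take = z , x∈p∪q⁺ (inj₁ (x∈⁅x⁆ z)) , z~ (∈-fromList⁺ x∈take)
  ... | inj₂ x∈drop with y , y∈ , y~x ← B~ x∈drop = y , x∈p∪q⁺ (inj₂ y∈) , y~x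

SmallDominating : Graph n → ℕ → Set
SmallDominating G m = ∃[ S ] (∣ S ∣ ≤ m × Dominating G S)

smallDominating? : (G : Graph n) → Decidable (SmallDominating G)
smallDominating? G m = anySubset? λ S → (∣ S ∣ ℕ.≤? m) ×-dec dominating? G S

dominatingSets : (G : Graph (suc n)) →
  ∃[ a ] ∃[ b ] (SmallDominating G a × SmallDominating (G ᶜ) b × a * b ≤ 4 * suc n)
dominatingSets {n} G
  with threshold (smallDominating? (G ᶜ))
         (λ (S , ∣S∣≤0 , dom) → ℕ.<⇒≱ (dominating⇒nonempty (G ᶜ) dom) ∣S∣≤0)
         (suc n) (⊤ , ∣p∣≤n ⊤ , ⊤-dominating (G ᶜ))
... | zero , _ , _ , dom₁ =
  suc n , 1 , (⊤ , ∣p∣≤n ⊤ , ⊤-dominating G) , dom₁ ,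
  ℕ.≤-trans (ℕ.≤-reflexive (ℕ.*-comm (suc n) 1)) (ℕ.*-monoˡ-≤ (suc n) {1} {4} (s≤s z≤n))
... | m@(suc m′) , m<N , ¬dom , dom₊ =
  q , suc m , dominating cover , dom₊ , bound
  where
  N = suc n
  -- The extra block absorbs the remainder of `N` modulo `m`.
  q = suc (N / m)

  N≤q*m : N ≤ q * m
  N≤q*m = ℕ.≤-trans (ℕ.≤-reflexive (m≡m%n+[m/n]*n N m))
    (ℕ.+-monoˡ-≤ (N / m * m) (ℕ.<⇒≤ (m%n<n N m)))

  cover = blockCover G m
    (λ S ∣S∣≤m → nonDominatingᶜ⇒commonNeighbour G λ dom → ¬dom (S , ∣S∣≤m , dom))
    q (allFin N) (ℕ.≤-trans (ℕ.≤-reflexive (List.length-tabulate {n = N} (λ i → i))) N≤q*m)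

  dominating : ∃[ B ] (∣ B ∣ ≤ q × (∀ {x} → x ∈ˡ allFin N → ∃[ y ] (y ∈ B × Adj G y x))) →
               SmallDominating G q
  dominating (B , ∣B∣≤q , B~) = B , ∣B∣≤q , λ w → inj₂ (B~ (∈-allFin w))

  bound : q * suc m ≤ 4 * N
  bound = begin
    -- As `m = suc m′`, the number `suc (m + m′)` is `2 * m`, which bounds `suc m`.
    q * suc m          ≤⟨ ℕ.*-monoʳ-≤ q (s≤s (ℕ.m≤m+n m m′)) ⟩
    q * suc (m + m′)   ≡⟨ double (N / m) m′ ⟩
    2 * (m + N / m * m) ≤⟨ ℕ.*-monoʳ-≤ 2 (ℕ.+-mono-≤ (ℕ.<⇒≤ m<N) (m/n*n≤m N m)) ⟩
    2 * (N + N)        ≡⟨ quadruple N ⟩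
    4 * N              ∎
    where
    open ℕ.≤-Reasoning

    double : ∀ d k → suc d * suc (suc k + k) ≡ 2 * (suc k + d * suc k)
    double = solve-∀

    quadruple : ∀ k → 2 * (k + k) ≡ 4 * k
    quadruple = solve-∀

-- Each factor contributes 2 for the single domination step, and the product of the two set sizes
-- contributes `4 * suc n`.
thProduct≤16n : (G : Graph (suc n)) → thProduct G ≤ 16 * suc n
thProduct≤16n {n} G =
  let a , b , (S , ∣S∣≤a , domS) , (T , ∣T∣≤b , domT) , ab≤4n = dominatingSets G in begin
    th G * th (G ᶜ)            ≤⟨ ℕ.*-mono-≤ (th≤2∣S∣ G domS) (th≤2∣S∣ (G ᶜ) domT) ⟩
    (∣ S ∣ * 2) * (∣ T ∣ * 2)  ≤⟨ ℕ.*-mono-≤ (ℕ.*-monoˡ-≤ 2 ∣S∣≤a) (ℕ.*-monoˡ-≤ 2 ∣T∣≤b) ⟩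
    (a * 2) * (b * 2)          ≡⟨ collect a b ⟩
    4 * (a * b)                ≤⟨ ℕ.*-monoʳ-≤ 4 ab≤4n ⟩
    4 * (4 * suc n)            ≡⟨ ℕ.*-assoc 4 4 (suc n) ⟨
    16 * suc n                 ∎
  where
  open ℕ.≤-Reasoning

  collect : ∀ a b → (a * 2) * (b * 2) ≡ 4 * (a * b)
  collect = solve-∀

-- Triangles joined at their hubs.

triangle : Fin n → ℕ
triangle v = toℕ v / 3

Hub : Fin n → Set
Hub v = toℕ v % 3 ≡ 0

-- When 3 ∤ n the last triangle is truncated.
hubbedTriangles : ∀ n → Graph n
hubbedTriangles n .Adj u v  = u ≢ v × (triangle u ≡ triangle v ⊎ Hub u × Hub v)
hubbedTriangles n .adj? u v = ¬? (u Fin.≟ v) ×-dec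
  ((triangle u ℕ.≟ triangle v) ⊎-dec ((toℕ u % 3 ℕ.≟ 0) ×-dec (toℕ v % 3 ℕ.≟ 0)))
hubbedTriangles n .symm (u≢v , inj₁ same)      = u≢v ∘ sym , inj₁ (sym same)
hubbedTriangles n .symm (u≢v , inj₂ (hu , hv)) = u≢v ∘ sym , inj₂ (hv , hu)
hubbedTriangles n .irrefl v (v≢v , _)          = v≢v refl

-- Corner `i` of triangle `g`, with corner 0 the hub; the bound `g < n / 3` selects the complete
-- triangles.
vertex : ∀ n {i g} → i < 3 → g < n / 3 → Fin n
vertex n {i} {g} i<3 g< = fromℕ< {i + g * 3} (ℕ.≤-trans
  (ℕ.+-monoˡ-≤ (g * 3) i<3) (ℕ.≤-trans (ℕ.*-monoˡ-≤ 3 g<) (m/n*n≤m n 3)))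

toℕ-vertex : ∀ n {i g} (i<3 : i < 3) (g< : g < n / 3) → toℕ (vertex n i<3 g<) ≡ i + g * 3
toℕ-vertex n i<3 g< = Fin.toℕ-fromℕ< _

triangle-vertex : ∀ n {i g} (i<3 : i < 3) (g< : g < n / 3) → triangle (vertex n i<3 g<) ≡ g
triangle-vertex n {i} {g} i<3 g< = trans (cong (_/ 3) (toℕ-vertex n i<3 g<))
  (trans (+-distrib-/-∣ʳ i (n∣m*n g)) (cong₂ _+_ (m<n⇒m/n≡0 i<3) (m*n/n≡m g 3)))

offset-vertex : ∀ n {i g} (i<3 : i < 3) (g< : g < n / 3) → toℕ (vertex n i<3 g<) % 3 ≡ i % 3
offset-vertex n {i} {g} i<3 g< = trans (cong (_% 3) (toℕ-vertex n i<3 g<)) ([m+kn]%n≡m%n i g 3)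

-- Connectivity of the construction and of its complement.

module _ {n} (2≤n/3 : 2 ≤ n / 3) where

  private
    G = hubbedTriangles n

    0<3 : 0 < 3
    0<3 = s≤s z≤n

    1<3 : 1 < 3
    1<3 = s≤s (s≤s z≤n)

    2<3 : 2 < 3
    2<3 = s≤s (s≤s (s≤s z≤n))

    connectedVia : (H : Graph n) (h : Fin n) → (∀ v → Star (Adj H) v h) → Connected H
    connectedVia H h path u v = path u ◅◅ Star.reverse (symm H) (path v)

    -- Allowing equal endpoints absorbs the cases where a vertex is its own hub or the hub is
    -- already the root.
    edge⁼ : ∀ {u v} → triangle u ≡ triangle v ⊎ Hub u × Hub v → Star (Adj G) u v
    edge⁼ {u} {v} related with u Fin.≟ v
    ... | yes refl = ε
    ... | no u≢v   = (u≢v , related) ◅ ε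

    edgeᶜ : ∀ u v → triangle u ≢ triangle v → ¬ Hub v → Adj (G ᶜ) u v
    edgeᶜ u v apart ¬hub = (λ { refl → apart refl }) ,
      λ { (_ , inj₁ same) → apart same ; (_ , inj₂ (_ , hub)) → ¬hub hub }

    connected : Connected G
    connected = connectedVia G root λ v → edge⁼ {v} {hub v} (inj₁ (sym (hub-triangle v)))
      ◅◅ edge⁼ {hub v} {root} (inj₂ (hub-hub v , offset-vertex n 0<3 0<n/3))
      where
      0<n/3 : 0 < n / 3
      0<n/3 = ℕ.<-trans (s≤s z≤n) 2≤n/3

      root : Fin n
      root = vertex n 0<3 0<n/3

      hub : Fin n → Fin n
      -- Rounding down to a multiple of 3 stays below `n`, so a truncated triangle has its hub too.
      hub v = fromℕ< (ℕ.≤-<-trans (m/n*n≤m (toℕ v) 3) (Fin.toℕ<n v))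

      toℕ-hub : ∀ v → toℕ (hub v) ≡ triangle v * 3
      toℕ-hub v = Fin.toℕ-fromℕ< _

      hub-triangle : ∀ v → triangle (hub v) ≡ triangle v
      hub-triangle v = trans (cong (_/ 3) (toℕ-hub v)) (m*n/n≡m (triangle v) 3)

      hub-hub : ∀ v → Hub (hub v)
      hub-hub v = trans (cong (_% 3) (toℕ-hub v)) (m*n%n≡0 (triangle v) 3)

    connectedᶜ : Connected (G ᶜ)
    connectedᶜ = connectedVia (G ᶜ) root path
      where
      0<n/3 : 0 < n / 3
      0<n/3 = ℕ.<-trans (s≤s z≤n) 2≤n/3

      root other : Fin n
      -- Corner 1 is not a hub, so in the complement it is adjacent to every vertex outside its
      -- triangle.
      root  = vertex n 1<3 0<n/3
      other = vertex n 1<3 2≤n/3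

      nonHub : ∀ {g} (g< : g < n / 3) → ¬ Hub (vertex n 1<3 g<)
      nonHub g< hub = contradiction (trans (sym (offset-vertex n 1<3 g<)) hub) λ ()

      apart : ∀ {u g h} (g< : g < n / 3) → triangle u ≡ h → h ≢ g →
              triangle u ≢ triangle (vertex n 1<3 g<)
      apart g< u≡h h≢g same = h≢g (trans (sym u≡h) (trans same (triangle-vertex n 1<3 g<)))

      path : ∀ v → Star (Adj (G ᶜ)) v root
      path v with triangle v ℕ.≟ 0
      ... | no  v≢0 = edgeᶜ v root (apart {v} 0<n/3 refl v≢0) (nonHub 0<n/3) ◅ ε
      -- The complement has no edge inside triangle 0, so the path detours through triangle 1.
      ... | yes v≡0 = edgeᶜ v other (apart {v} 2≤n/3 v≡0 λ ()) (nonHub 2≤n/3)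
        ◅ edgeᶜ other root (apart {other} 0<n/3 (triangle-vertex n 1<3 2≤n/3) λ ()) (nonHub 0<n/3) ◅ ε

  hubbedTriangles-coconnected : Coconnected (hubbedTriangles n)
  hubbedTriangles-coconnected = connected , connectedᶜ

  -- Power dominating sets meet every complete triangle.

  module _ (B : Subset n) {g} (g< : g < n / 3) (avoids : ∀ v → v ∈ B → triangle v ≢ g) where

    private
      x y : Fin n
      x = vertex n 1<3 g<
      y = vertex n 2<3 g<

      x≢y : x ≢ y
      x≢y eq = contradiction
        (trans (sym (offset-vertex n 1<3 g<)) (trans (cong (λ v → toℕ v % 3) eq) (offset-vertex n 2<3 g<)))
        λ ()

      neighbour-triangle : ∀ {i} (i<3 : i < 3) → i % 3 ≢ 0 → ∀ {v} →
                           Adj G v (vertex n i<3 g<) → triangle v ≡ g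
      neighbour-triangle i<3 i≢0 (_ , inj₁ same)      = trans same (triangle-vertex n i<3 g<)
      neighbour-triangle i<3 i≢0 (_ , inj₂ (_ , hub)) =
        contradiction (trans (sym (offset-vertex n i<3 g<)) hub) i≢0

      notInN : ∀ {i} (i<3 : i < 3) → i % 3 ≢ 0 → vertex n i<3 g< ∉ N[_] G B
      notInN i<3 i≢0 w∈ with ∈-subset⁻ (inN[_]? G B) w∈
      ... | inj₁ w∈B            = avoids _ w∈B (triangle-vertex n i<3 g<)
      ... | inj₂ (v , v∈ , v~w) = avoids v v∈ (neighbour-triangle i<3 i≢0 v~w)

      -- A vertex forcing one non-hub corner lies in the same triangle, hence is adjacent to the
      -- other unobserved corner as well and has two unobserved neighbours.
      notForced : ∀ {i j} (i<3 : i < 3) (j<3 : j < 3) → i % 3 ≢ 0 →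
                  vertex n i<3 g< ≢ vertex n j<3 g< →
                  ∀ {S} → vertex n i<3 g< ∉ S → vertex n j<3 g< ∉ S → vertex n i<3 g< ∉ step G S
      notForced i<3 j<3 i≢0 w≢z {S} w∉ z∉ w∈ with ∈-subset⁻ (inStep? G S) w∈
      ... | inj₁ w∈S = w∉ w∈S
      ... | inj₂ (v , v∈ , v~w , _ , only) = w≢z (sym (only _ v~z z∉))
        where
        v~z : Adj G v (vertex n j<3 g<)
        v~z = (λ { refl → z∉ v∈ }) ,
          inj₁ (trans (neighbour-triangle i<3 i≢0 v~w) (sym (triangle-vertex n j<3 g<)))

      -- The induction carries both corners at once, since each blocks the forcing of the other.
      unobserved : ∀ t → x ∉ monitored G B t × y ∉ monitored G B t
      unobserved 0 = (λ x∈ → avoids x x∈ (triangle-vertex n 1<3 g<)) ,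
                     (λ y∈ → avoids y y∈ (triangle-vertex n 2<3 g<))
      unobserved 1 = notInN 1<3 (λ ()) , notInN 2<3 (λ ())
      unobserved (suc (suc t)) with x∉ , y∉ ← unobserved (suc t) =
        notForced 1<3 2<3 (λ ()) x≢y x∉ y∉ , notForced 2<3 1<3 (λ ()) (x≢y ∘ sym) y∉ x∉

    avoidsTriangle⇒incomplete : ∀ t → monitored G B t ≢ ⊤
    avoidsTriangle⇒incomplete t eq = proj₁ (unobserved t) (subst (x ∈_) (sym eq) ∈⊤)

  n/3≤∣powerDominating∣ : ∀ B t → monitored G B t ≡ ⊤ → n / 3 ≤ ∣ B ∣
  -- The chosen vertices are distinct because `triangle` recovers the index from each.
  n/3≤∣powerDominating∣ B t mon≡⊤ = injection⇒≤∣p∣ (proj₁ ∘ meets)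
    (λ {i} {j} eq → Fin.toℕ-injective
      (trans (sym (proj₂ (proj₂ (meets i)))) (trans (cong triangle eq) (proj₂ (proj₂ (meets j))))))
    B (proj₁ ∘ proj₂ ∘ meets)
    where
    meets : (i : Fin (n / 3)) → ∃[ v ] (v ∈ B × triangle v ≡ toℕ i)
    meets i with Fin.any? (λ v → (v ∈? B) ×-dec (triangle v ℕ.≟ toℕ i))
    ... | yes met = met
    ... | no ¬met = contradiction mon≡⊤
      (avoidsTriangle⇒incomplete B (Fin.toℕ<n i) (λ v v∈ eq → ¬met (v , v∈ , eq)) t)

-- Linear bounds for `Mc`.

n/3≤Mc : 6 ≤ n → n / 3 ≤ Mc n
n/3≤Mc {n@(suc _)} 6≤n = begin
  n / 3         ≤⟨ n/3≤th ⟩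
  th G          ≡⟨ ℕ.*-identityʳ (th G) ⟨
  th G * 1      ≤⟨ ℕ.*-monoʳ-≤ (th G) (1≤th (G ᶜ)) ⟩
  thProduct G   ≤⟨ product-≤-Mc G (hubbedTriangles-coconnected 2≤n/3) ⟩
  Mc n          ∎
  where
  open ℕ.≤-Reasoning

  G : Graph n
  G = hubbedTriangles n

  2≤n/3 : 2 ≤ n / 3
  2≤n/3 = /-monoˡ-≤ 3 6≤n

  n/3≤th : n / 3 ≤ th G
  n/3≤th = let B , t , _ , mon≡⊤ , th≡ = th-attained G in
    subst (n / 3 ≤_) (sym th≡)
      (ℕ.≤-trans (n/3≤∣powerDominating∣ 2≤n/3 B t mon≡⊤) (ℕ.m≤m*n ∣ B ∣ (1 + t)))

-- For `n` at least 6 the remainder modulo 3 is at most `n / 3 * 3`, so `n` is at most twice that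
-- multiple of 3.
n≤6Mc : 6 ≤ n → n ≤ Mc n * 6
n≤6Mc {n} 6≤n = begin
  n                          ≡⟨ m≡m%n+[m/n]*n n 3 ⟩
  n % 3 + n / 3 * 3          ≤⟨ ℕ.+-monoˡ-≤ (n / 3 * 3) remainder≤ ⟩
  n / 3 * 3 + n / 3 * 3      ≡⟨ ℕ.*-distribˡ-+ (n / 3) 3 3 ⟨
  n / 3 * 6                  ≤⟨ ℕ.*-monoˡ-≤ 6 (n/3≤Mc 6≤n) ⟩
  Mc n * 6                   ∎
  where
  open ℕ.≤-Reasoning

  remainder≤ : n % 3 ≤ n / 3 * 3
  remainder≤ = ℕ.≤-trans (ℕ.<⇒≤ (m%n<n n 3))
    (ℕ.*-monoˡ-≤ 3 (ℕ.≤-trans (s≤s z≤n) (/-monoˡ-≤ 3 6≤n)))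

Mc≤16n : 4 ≤ n → Mc n ≤ 16 * n
Mc≤16n {suc n} 4≤n = let (G , _ , Mc≡) , _ = Mc-isMaximum 4≤n in
  subst (_≤ 16 * suc n) (sym Mc≡) (thProduct≤16n G)

-- Transfer to rational constants.

toℚᵘ-product : ∀ a d n → ℚ.toℚᵘ ((+ a ℚ./ suc d) ℚ.* (+ n ℚ./ 1)) ℚᵘ.≃ mkℚᵘ (+ a) d ℚᵘ.* mkℚᵘ (+ n) 0
toℚᵘ-product a d n = ℚᵘ.≃-trans (ℚ.toℚᵘ-homo-* (+ a ℚ./ suc d) (+ n ℚ./ 1))
  (ℚᵘ.*-cong (ℚ.toℚᵘ-fromℚᵘ (mkℚᵘ (+ a) d)) (ℚ.toℚᵘ-fromℚᵘ (mkℚᵘ (+ n) 0)))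

-- Unnormalised fractions are not reduced, so the inequality becomes cross-multiplication of
-- integers, where the hypothesis applies.
scale-≤ : ∀ a d n m → a * n ≤ m * suc d → (+ a ℚ./ suc d) ℚ.* (+ n ℚ./ 1) ℚ.≤ + m ℚ./ 1
scale-≤ a d n m le = ℚ.toℚᵘ-cancel-≤
  (ℚᵘ.≤-respˡ-≃ (ℚᵘ.≃-sym (toℚᵘ-product a d n))
  (ℚᵘ.≤-respʳ-≃ (ℚᵘ.≃-sym (ℚ.toℚᵘ-fromℚᵘ (mkℚᵘ (+ m) 0))) (ℚᵘ.*≤* (begin
    (+ a ℤ.* + n) ℤ.* + 1  ≡⟨ ℤ.*-identityʳ _ ⟩
    + a ℤ.* + n            ≡⟨ ℤ.pos-* a n ⟨
    + (a * n)              ≤⟨ +≤+ le ⟩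
    + (m * suc d)          ≡⟨ cong (λ k → + (m * k)) (ℕ.*-identityʳ (suc d)) ⟨
    + (m * (suc d * 1))    ≡⟨ ℤ.pos-* m (suc d * 1) ⟩
    + m ℤ.* + (suc d * 1)  ∎))))
  where open ℤ.≤-Reasoning

≤-scale : ∀ a n m → m ≤ a * n → + m ℚ./ 1 ℚ.≤ (+ a ℚ./ 1) ℚ.* (+ n ℚ./ 1)
≤-scale a n m le = ℚ.toℚᵘ-cancel-≤
  (ℚᵘ.≤-respˡ-≃ (ℚᵘ.≃-sym (ℚ.toℚᵘ-fromℚᵘ (mkℚᵘ (+ m) 0)))
  (ℚᵘ.≤-respʳ-≃ (ℚᵘ.≃-sym (toℚᵘ-product a 0 n)) (ℚᵘ.*≤* (begin
    + m ℤ.* + 1            ≡⟨ ℤ.*-identityʳ _ ⟩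
    + m                    ≤⟨ +≤+ le ⟩
    + (a * n)              ≡⟨ ℤ.pos-* a n ⟩
    + a ℤ.* + n            ≡⟨ ℤ.*-identityʳ _ ⟨
    (+ a ℤ.* + n) ℤ.* + 1  ∎))))
  where open ℤ.≤-Reasoning

corollary4p18 : Mc =Θ (λ n → n)
-- The constants come from `n ≤ Mc n * 6` and `Mc n ≤ 16 * n`; from 6 on there are two complete
-- triangles. The argument `5` below stands for the denominator `suc 5`.
corollary4p18 = + 1 ℚ./ 6 , + 16 ℚ./ 1 , 6 ,
  toWitness {a? = 0ℚ ℚ.<? + 1 ℚ./ 6} _ , toWitness {a? = 0ℚ ℚ.<? + 16 ℚ./ 1} _ , s≤s z≤n ,
  λ n 6≤n →
    scale-≤ 1 5 n (Mc n) (ℕ.≤-trans (ℕ.≤-reflexive (ℕ.*-identityˡ n)) (n≤6Mc 6≤n)) ,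
    ≤-scale 16 n (Mc n) (Mc≤16n (ℕ.≤-trans (ℕ.m≤m+n 4 2) 6≤n))
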